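{- For every $\varepsilon>0$ and positive integers $t,r$, if $n$ is large enough and $\mathcal F\subseteq 2^{[n]}$ has size at least $(t+\varepsilon)\binom{n}{\lfloor n/2\rfloor}$, then there exists $F\in\mathcal F$ such that $F$ is the bottom element of an induced copy of $\vee_{\delta n^t}$ in $\mathcal F$, where $\delta=\frac{\varepsilon}{2^{t+3}t!}$; that is, there exist at least $\delta n^t$ pairwise incomparable sets $G\in\mathcal F$ with $F\subsetneq G$.
   Context: $\vee_k$ is the poset with elements $a,b_1,\dots,b_k$, $a<b_j$ for all $j$, the $b_j$ pairwise incomparable. An induced copy of $\vee_k$ in $\mathcal F$ with bottom element $F$ consists of $F\in\mathcal F$ together with $k$ pairwise incomparable (under inclusion) sets of $\mathcal F$ each properly containing $F$.
   Formalization: The formal theorem takes ε to be a positive rational number, where the statement allows any positive real ε. -}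

module Defs where

open import Data.Nat using (ℕ; _*_; _^_; _+_; _/_)
open import Data.Nat.Combinatorics using (_C_)
open import Data.Nat using (_!)
open import Data.Integer using (+_)
import Data.Rational as ℚ
open import Data.Rational using (ℚ)
open import Data.Fin.Subset using (Subset; _⊂_; _⊆_)
open import Data.List using (List; length)
open import Data.List.Relation.Unary.All using (All)
open import Data.List.Relation.Unary.Unique.Propositional using (Unique)
open import Data.List.Relation.Unary.AllPairs using (AllPairs)
open import Data.List.Membership.Propositional using (_∈_)
open import Data.Product using (_×_)
open import Relation.Nullary using (¬_)

ℕ→ℚ : ℕ → ℚ
ℕ→ℚ k = (+ k) ℚ./ 1

record Family (n : ℕ) : Set where
  field
    sets   : List (Subset n)
    unique : Unique sets
open Family public

Incomparable : ∀ {n} → Subset n → Subset n → Set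
Incomparable G H = ¬ (G ⊆ H) × ¬ (H ⊆ G)

InducedVeeAbove : ∀ {n} → Family n → Subset n → List (Subset n) → Set
InducedVeeAbove 𝓕 F Gs =
  All (λ G → G ∈ sets 𝓕 × F ⊂ G) Gs × AllPairs Incomparable Gs

-- (k : ℚ) ≥ δ n^t  with δ = ε / (2^(t+3) t!), written multiplied out:
--   k * (2^(t+3) * t!) ≥ ε * n^t
AtLeastδnᵗ : ℚ → ℕ → ℕ → ℕ → Set
AtLeastδnᵗ ε t n k = ε ℚ.* ℕ→ℚ (n ^ t) ℚ.≤ ℕ→ℚ (k * (2 ^ (t + 3) * t !))

{-# OPTIONS --safe #-}
-- Truncate 𝓕 to the sets G with ∣ G ∣ ≤ U, where U = n/2 + o(n): binomial coefficients decay
-- geometrically beyond n/2 + n/b, so only (ε/2) C(n, n/2) sets are lost.  For a set S of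
-- codimension m let V(S) be the expected number of members on a random maximal chain from S
-- to [n].  If S ∈ 𝓕, the levels 0, …, t-1 above S contribute at most 1 each to V(S).  If no level
-- j ≥ t above S has δ n^t members, the remaining contribution is at most
-- δ n^t Σ_{j ≥ t} 1 / C(m, j), which is dominated by the term j = t, about (n/2)^t / t!, and
-- hence less than ε/2.  If S ∉ 𝓕, V(S) is the average of V over the upper covers of S.  So
-- V < t + ε/2 everywhere, whereas V(∅) ≥ ∣𝓕∣ / C(n, n/2) gives V(∅) ≥ t + ε/2.
-- Multiplying by m! and writing ε = p/q keeps everything in ℕ.
module Submission where

open import Defs
open import Data.Nat using (ℕ; _≤_; _<_; _/_)
open import Data.Nat.Combinatorics using (_C_)
import Data.Rational as ℚ
open import Data.Rational using (ℚ)
open import Data.Fin.Subset using (Subset)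
open import Data.List using (List; length)
open import Data.List.Membership.Propositional using (_∈_)
open import Data.Product using (Σ; ∃; _×_)

import Algebra.Properties.CommutativeSemigroup as CommutativeSemigroupProperties
import Data.Bool.Properties as Bool
open import Data.Bool using (true; false; if_then_else_)
open import Data.Empty using (⊥-elim)
open import Data.Fin.Subset using (_⊆_; _⊂_; ∣_∣; inside; outside; ⊥)
open import Data.Fin.Subset.Properties hiding (_∈?_)
import Data.Integer as ℤ
import Data.Integer.Properties as ℤ
open import Data.Integer using (-[1+_]; +≤+; +<+; drop‿+≤+) renaming (+_ to pos)
open import Data.List using ([]; _∷_; _++_; map; filter)
import Data.List.Membership.DecPropositional as DecMembership
open import Data.List.Membership.Propositional using (find; lose)
open import Data.List.Membership.Propositional.Properties using (∈-filter⁻; ∈-++⁺ˡ; ∈-++⁺ʳ; ∈-map⁻)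
open import Data.List.Properties using (map-++; map-∘; length-map)
import Data.List.Relation.Unary.All as All
open import Data.List.Relation.Unary.AllPairs using (AllPairs; []; _∷_)
open import Data.List.Relation.Unary.Any using (here; there; any?)
open import Data.List.Relation.Unary.Unique.Propositional using (Unique)
import Data.List.Relation.Unary.Unique.Propositional.Properties as Unique
open import Data.Nat using (zero; suc; _+_; _*_; _∸_; _^_; _%_; _!; z≤n; s≤s; s≤s⁻¹; >-nonZero; _≟_; _≤?_)
open import Data.Nat.Combinatorics using (k![n∸k]!∣n!)
open import Data.Nat.Combinatorics.Specification using (nCk≡n!/k![n-k]!; k>n⇒nCk≡0)
open import Data.Nat.Coprimality using (Coprime)
open import Data.Nat.DivMod using (m/n*n≡m; m/n*n≤m; m≡m%n+[m/n]*n; m%n<n; m/n≤m; m≥n⇒m/n>0)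
open import Data.Nat.ListAction using (sum)
open import Data.Nat.ListAction.Properties using (sum-++)
open import Data.Nat.Properties
open import Data.Nat.Tactic.RingSolver using (solve-∀)
open import Data.Product using (_,_; proj₁; proj₂)
open import Data.Rational using (mkℚ; *<*; toℚᵘ)
open import Data.Rational.Properties using (toℚᵘ-homo-+; toℚᵘ-homo-*; toℚᵘ-fromℚᵘ; toℚᵘ-mono-≤; toℚᵘ-cancel-≤)
import Data.Rational.Unnormalised as ℚᵘ
import Data.Rational.Unnormalised.Properties as ℚᵘ
open import Data.Rational.Unnormalised using (mkℚᵘ; *≤*)
open import Data.Sum using (_⊎_; inj₁; inj₂)
open import Data.Vec using ([]; _∷_)
import Data.Vec.Properties as Vec
open import Function using (_∘_)
open import Relation.Binary.Definitions using (tri<; tri≈; tri>)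
open import Relation.Binary.PropositionalEquality using (_≡_; _≢_; refl; sym; trans; cong; cong₂; subst; subst₂; module ≡-Reasoning)
open import Relation.Nullary using (¬?; yes; no; does; contradiction)
open import Relation.Nullary.Decidable using (dec-true; _×-dec_)
open import Relation.Unary using (Decidable)

open CommutativeSemigroupProperties +-commutativeSemigroup using () renaming (interchange to +-interchange)
open CommutativeSemigroupProperties *-commutativeSemigroup using () renaming (interchange to *-interchange; x∙yz≈y∙xz to *-swapˡ)

private variable
  A : Set
  n : ℕ

-- Finite sums over lists and integer intervals

∑ : List A → (A → ℕ) → ℕ
∑ xs f = sum (map f xs)

∑-mono : (xs : List A) {f g : A → ℕ} → (∀ {x} → x ∈ xs → f x ≤ g x) → ∑ xs f ≤ ∑ xs g
∑-mono []       f≤g = z≤n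
∑-mono (x ∷ xs) f≤g = +-mono-≤ (f≤g (here refl)) (∑-mono xs (f≤g ∘ there))

∑-cong : (xs : List A) {f g : A → ℕ} → (∀ {x} → x ∈ xs → f x ≡ g x) → ∑ xs f ≡ ∑ xs g
∑-cong []       f≡g = refl
∑-cong (x ∷ xs) f≡g = cong₂ _+_ (f≡g (here refl)) (∑-cong xs (f≡g ∘ there))

∑-const : (xs : List A) (c : ℕ) → ∑ xs (λ _ → c) ≡ length xs * c
∑-const []       c = refl
∑-const (x ∷ xs) c = cong (c +_) (∑-const xs c)

∑-zero : (xs : List A) {f : A → ℕ} → (∀ {x} → x ∈ xs → f x ≡ 0) → ∑ xs f ≡ 0
∑-zero xs f≡0 = trans (∑-cong xs f≡0) (trans (∑-const xs 0) (*-zeroʳ (length xs)))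

∑-bound : (xs : List A) {f : A → ℕ} {c : ℕ} → (∀ {x} → x ∈ xs → f x ≤ c) → ∑ xs f ≤ length xs * c
∑-bound xs f≤c = ≤-trans (∑-mono xs f≤c) (≤-reflexive (∑-const xs _))

∑-distrib-+ : (xs : List A) (f g : A → ℕ) → ∑ xs (λ x → f x + g x) ≡ ∑ xs f + ∑ xs g
∑-distrib-+ []       f g = refl
∑-distrib-+ (x ∷ xs) f g = trans (cong (f x + g x +_) (∑-distrib-+ xs f g)) (+-interchange (f x) (g x) _ _)

∑-*ˡ : (c : ℕ) (xs : List A) (f : A → ℕ) → c * ∑ xs f ≡ ∑ xs (λ x → c * f x)
∑-*ˡ c []       f = *-zeroʳ c
∑-*ˡ c (x ∷ xs) f = trans (*-distribˡ-+ c (f x) _) (cong (c * f x +_) (∑-*ˡ c xs f))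

∑-swap : {B : Set} (xs : List A) (ys : List B) (f : A → B → ℕ) →
  ∑ xs (λ x → ∑ ys (f x)) ≡ ∑ ys (λ y → ∑ xs (λ x → f x y))
∑-swap []       ys f = sym (∑-zero ys (λ _ → refl))
∑-swap (x ∷ xs) ys f =
  trans (cong (∑ ys (f x) +_) (∑-swap xs ys f)) (sym (∑-distrib-+ ys (f x) _))

∑-++ : (xs ys : List A) (f : A → ℕ) → ∑ (xs ++ ys) f ≡ ∑ xs f + ∑ ys f
∑-++ xs ys f = trans (cong sum (map-++ f xs ys)) (sum-++ (map f xs) _)

∑-map : {B : Set} (g : A → B) (xs : List A) (f : B → ℕ) → ∑ (map g xs) f ≡ ∑ xs (f ∘ g)
∑-map g xs f = cong sum (sym (map-∘ xs))

∑-filter : {P : A → Set} (P? : Decidable P) (xs : List A) (f : A → ℕ) →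
  ∑ (filter P? xs) f ≡ ∑ xs (λ x → if does (P? x) then f x else 0)
∑-filter P? []       f = refl
∑-filter P? (x ∷ xs) f with does (P? x)
... | true  = cong (f x +_) (∑-filter P? xs f)
... | false = ∑-filter P? xs f

∈⇒≤∑ : {xs : List A} {x : A} (f : A → ℕ) → x ∈ xs → f x ≤ ∑ xs f
∈⇒≤∑ f (here refl)          = m≤m+n _ _
∈⇒≤∑ f (there {x = y} x∈xs) = ≤-trans (∈⇒≤∑ f x∈xs) (m≤n+m _ (f y))

∑-single : {xs : List A} (x : A) (f : A → ℕ) → Unique xs →
  (∀ {y} → y ∈ xs → x ≢ y → f y ≡ 0) → x ∈ xs → ∑ xs f ≤ f x
∑-single {xs = _ ∷ xs} x f (x∉ ∷ _) zero-off (here refl) =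
  ≤-reflexive (trans (cong (f x +_) (∑-zero xs λ y∈ → zero-off (there y∈) (All.lookup x∉ y∈))) (+-identityʳ _))
∑-single {xs = y ∷ _} x f (y∉ ∷ uniq) zero-off (there x∈)
  rewrite zero-off (here refl) (All.lookup y∉ x∈ ∘ sym) = ∑-single x f uniq (zero-off ∘ there) x∈

-- Every nonzero term reappears in the fibre of its own key. The list `ks` may repeat or overshoot
-- keys, hence only an inequality. Terms equal to 0 need no key, so sets that do not contain `S` can
-- be ignored when chains from `S` are counted.
∑-fibres : (key : A → ℕ) (ks : List ℕ) (xs : List A) (f : A → ℕ) →
  (∀ {x} → x ∈ xs → f x ≡ 0 ⊎ key x ∈ ks) →
  ∑ xs f ≤ ∑ ks (λ k → ∑ (filter (λ x → key x ≟ k) xs) f)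
∑-fibres key ks xs f covered = begin
  ∑ xs f                                                              ≤⟨ ∑-mono xs pointwise ⟩
  ∑ xs (λ x → ∑ ks (λ k → if does (key x ≟ k) then f x else 0))       ≡⟨ ∑-swap xs ks _ ⟩
  ∑ ks (λ k → ∑ xs (λ x → if does (key x ≟ k) then f x else 0))       ≡⟨ ∑-cong ks (λ {k} _ → sym (∑-filter (λ x → key x ≟ k) xs f)) ⟩
  ∑ ks (λ k → ∑ (filter (λ x → key x ≟ k) xs) f)                      ∎
  where
  open ≤-Reasoning
  diagonal : ∀ k v → (if does (k ≟ k) then v else 0) ≡ v
  diagonal k v = cong (λ b → if b then v else 0) (dec-true (k ≟ k) refl)
  pointwise : ∀ {x} → x ∈ xs → f x ≤ ∑ ks (λ k → if does (key x ≟ k) then f x else 0)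
  pointwise {x} x∈ with covered x∈
  ... | inj₁ fx≡0 = ≤-trans (≤-reflexive fx≡0) z≤n
  ... | inj₂ k∈   = ≤-trans (≤-reflexive (sym (diagonal (key x) (f x)))) (∈⇒≤∑ (λ k → if does (key x ≟ k) then f x else 0) k∈)

interval : ℕ → ℕ → List ℕ
interval a zero    = []
interval a (suc l) = a ∷ interval (suc a) l

length-interval : ∀ a l → length (interval a l) ≡ l
length-interval a zero    = refl
length-interval a (suc l) = cong suc (length-interval (suc a) l)

∈-interval⁺ : ∀ {a l k} → a ≤ k → k < a + l → k ∈ interval a l
∈-interval⁺ {a} {zero}  a≤k k<a+l = contradiction a≤k (<⇒≱ (subst (_ <_) (+-identityʳ a) k<a+l))
∈-interval⁺ {a} {suc l} {k} a≤k k<a+l with m≤n⇒m<n∨m≡n a≤k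
... | inj₁ a<k  = there (∈-interval⁺ a<k (subst (k <_) (+-suc a l) k<a+l))
... | inj₂ refl = here refl

∈-interval⁻ : ∀ {a l k} → k ∈ interval a l → a ≤ k
∈-interval⁻ {l = suc l} (here refl) = ≤-refl
∈-interval⁻ {l = suc l} (there k∈)  = <⇒≤ (∈-interval⁻ k∈)

-- Subsets ordered by inclusion and their upper covers

⊆∧∣∣≡⇒≡ : (S G : Subset n) → S ⊆ G → ∣ S ∣ ≡ ∣ G ∣ → S ≡ G
⊆∧∣∣≡⇒≡ []            []            S⊆G eq = refl
⊆∧∣∣≡⇒≡ (inside ∷ S)  (inside ∷ G)  S⊆G eq = cong (inside ∷_) (⊆∧∣∣≡⇒≡ S G (drop-∷-⊆ S⊆G) (suc-injective eq))
⊆∧∣∣≡⇒≡ (inside ∷ S)  (outside ∷ G) S⊆G eq = contradiction (S⊆G Data.Vec.here) λ()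
⊆∧∣∣≡⇒≡ (outside ∷ S) (outside ∷ G) S⊆G eq = cong (outside ∷_) (⊆∧∣∣≡⇒≡ S G (drop-∷-⊆ S⊆G) eq)
⊆∧∣∣≡⇒≡ (outside ∷ S) (inside ∷ G)  S⊆G eq = contradiction (p⊆q⇒∣p∣≤∣q∣ (drop-∷-⊆ S⊆G)) (<⇒≱ (≤-reflexive (sym eq)))

⊆∧≢⇒∣∣< : {S G : Subset n} → S ⊆ G → S ≢ G → ∣ S ∣ < ∣ G ∣
⊆∧≢⇒∣∣< S⊆G S≢G = ≤∧≢⇒< (p⊆q⇒∣p∣≤∣q∣ S⊆G) (S≢G ∘ ⊆∧∣∣≡⇒≡ _ _ S⊆G)

⊆∧∣∣<⇒⊂ : (S G : Subset n) → S ⊆ G → ∣ S ∣ < ∣ G ∣ → S ⊂ G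
⊆∧∣∣<⇒⊂ (inside ∷ S)  (inside ∷ G)  S⊆G lt = s⊂s (⊆∧∣∣<⇒⊂ S G (drop-∷-⊆ S⊆G) (s≤s⁻¹ lt))
⊆∧∣∣<⇒⊂ (inside ∷ S)  (outside ∷ G) S⊆G lt = contradiction (S⊆G Data.Vec.here) λ()
⊆∧∣∣<⇒⊂ (outside ∷ S) (outside ∷ G) S⊆G lt = out⊂ (⊆∧∣∣<⇒⊂ S G (drop-∷-⊆ S⊆G) lt)
⊆∧∣∣<⇒⊂ (outside ∷ S) (inside ∷ G)  S⊆G lt = out⊂in (drop-∷-⊆ S⊆G)

upperCovers : Subset n → List (Subset n)
upperCovers []            = []
upperCovers (inside ∷ S)  = map (inside ∷_) (upperCovers S)
upperCovers (outside ∷ S) = (inside ∷ S) ∷ map (outside ∷_) (upperCovers S)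

∣upperCover∣ : (S : Subset n) {S′ : Subset n} → S′ ∈ upperCovers S → ∣ S′ ∣ ≡ suc ∣ S ∣
∣upperCover∣ (inside ∷ S) S′∈ with ∈-map⁻ (inside ∷_) S′∈
... | _ , ∈S , refl = cong suc (∣upperCover∣ S ∈S)
∣upperCover∣ (outside ∷ S) (here refl) = refl
∣upperCover∣ (outside ∷ S) (there S′∈) with ∈-map⁻ (outside ∷_) S′∈
... | _ , ∈S , refl = ∣upperCover∣ S ∈S

length-upperCovers : (S : Subset n) → length (upperCovers S) ≡ n ∸ ∣ S ∣
length-upperCovers []            = refl
length-upperCovers (inside ∷ S)  = trans (length-map _ (upperCovers S)) (length-upperCovers S)
length-upperCovers (outside ∷ S) =
  trans (cong suc (trans (length-map _ (upperCovers S)) (length-upperCovers S)))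
        (sym (+-∸-assoc 1 (∣p∣≤n S)))

-- An upper cover of `S` inside `G` arises by adding one of the `∣ G ∣ ∸ ∣ S ∣` elements of `G`
-- missing from `S`; if `S` is not inside `G`, neither is any upper cover.
count-upperCovers : (S G : Subset n) (v : ℕ) →
  ∑ (upperCovers S) (λ S′ → if does (S′ ⊆? G) then v else 0) ≡
  (if does (S ⊆? G) then (∣ G ∣ ∸ ∣ S ∣) * v else 0)
count-upperCovers []            []            v = refl
count-upperCovers (inside ∷ S)  (inside ∷ G)  v =
  trans (∑-map (inside ∷_) (upperCovers S) _) (count-upperCovers S G v)
count-upperCovers (inside ∷ S)  (outside ∷ G) v =
  trans (∑-map (inside ∷_) (upperCovers S) _) (∑-zero (upperCovers S) (λ _ → refl))
count-upperCovers (outside ∷ S) (outside ∷ G) v =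
  trans (∑-map (outside ∷_) (upperCovers S) _) (count-upperCovers S G v)
count-upperCovers (outside ∷ S) (inside ∷ G)  v =
  trans (cong ((if does (S ⊆? G) then v else 0) +_)
          (trans (∑-map (outside ∷_) (upperCovers S) _) (count-upperCovers S G v)))
        step
  where
  step : (if does (S ⊆? G) then v else 0) + (if does (S ⊆? G) then (∣ G ∣ ∸ ∣ S ∣) * v else 0) ≡
         (if does (S ⊆? G) then (suc ∣ G ∣ ∸ ∣ S ∣) * v else 0)
  step with S ⊆? G
  ... | yes S⊆G = cong (_* v) (sym (+-∸-assoc 1 (p⊆q⇒∣p∣≤∣q∣ S⊆G)))
  ... | no  _   = refl

-- Maximal chains and the averaging argument

-- The number of maximal chains of the interval from S to the full set that pass through G.
chains : Subset n → Subset n → ℕ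
chains {n} S G = if does (S ⊆? G) then (∣ G ∣ ∸ ∣ S ∣) ! * (n ∸ ∣ G ∣) ! else 0

chains-refl : (S : Subset n) → chains S S ≡ (n ∸ ∣ S ∣) !
chains-refl {n} S with S ⊆? S
... | yes _   = trans (cong (λ k → k ! * (n ∸ ∣ S ∣) !) (n∸n≡0 ∣ S ∣)) (*-identityˡ _)
... | no  S⊈S = ⊥-elim (S⊈S λ x∈S → x∈S)

chains-⊈ : (S G : Subset n) → (S ⊆ G → S ≡ G) → S ≢ G → chains S G ≡ 0
chains-⊈ S G S⊆G⇒≡ S≢G with S ⊆? G
... | yes S⊆G = contradiction (S⊆G⇒≡ S⊆G) S≢G
... | no  _   = refl

-- A maximal chain from `S` through another set `G` passes through exactly one upper cover of `S`.
-- For `S ≡ G` the identity fails: the right side is then 0.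
chains-upperCovers : (S G : Subset n) → S ≢ G → chains S G ≡ ∑ (upperCovers S) (λ S′ → chains S′ G)
chains-upperCovers {n} S G S≢G = sym (begin
  ∑ (upperCovers S) (λ S′ → chains S′ G)
    ≡⟨ ∑-cong (upperCovers S) (λ {S′} S′∈ → cong (λ s → if does (S′ ⊆? G) then (∣ G ∣ ∸ s) ! * (n ∸ ∣ G ∣) ! else 0) (∣upperCover∣ S S′∈)) ⟩
  ∑ (upperCovers S) (λ S′ → if does (S′ ⊆? G) then v else 0)
    ≡⟨ count-upperCovers S G v ⟩
  (if does (S ⊆? G) then (∣ G ∣ ∸ ∣ S ∣) * v else 0)
    ≡⟨ step ⟩
  chains S G ∎)
  where
  open ≡-Reasoning
  v = (∣ G ∣ ∸ suc ∣ S ∣) ! * (n ∸ ∣ G ∣) !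
  unfold : ∀ a b r → a < b → (b ∸ a) * ((b ∸ suc a) ! * r) ≡ (b ∸ a) ! * r
  unfold a b r a<b rewrite +-∸-assoc 1 a<b = sym (*-assoc (suc (b ∸ suc a)) ((b ∸ suc a) !) r)
  step : (if does (S ⊆? G) then (∣ G ∣ ∸ ∣ S ∣) * v else 0) ≡ chains S G
  step with S ⊆? G
  ... | yes S⊆G = unfold ∣ S ∣ ∣ G ∣ _ (⊆∧≢⇒∣∣< S⊆G S≢G)
  ... | no  _   = refl

-- For S ∈ L the hypothesis applies; otherwise every chain through S and a member of L
-- continues through an upper cover of S, so the estimate is inherited by averaging.
∑-chains-bound : (L : List (Subset n)) (α β : ℕ) →
  (∀ {S} → S ∈ L → α * ∑ L (chains S) ≤ β * (n ∸ ∣ S ∣) !) →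
  (m : ℕ) (S : Subset n) → n ∸ ∣ S ∣ ≡ m → α * ∑ L (chains S) ≤ β * m !
∑-chains-bound {n} L α β bound = go
  where
  open DecMembership (Vec.≡-dec Bool._≟_) using (_∈?_)
  open ≤-Reasoning
  go : ∀ m S → n ∸ ∣ S ∣ ≡ m → α * ∑ L (chains S) ≤ β * m !

  covers-bound : ∀ m (S : Subset n) → n ∸ ∣ S ∣ ≡ m →
    ∑ (upperCovers S) (λ S′ → α * ∑ L (chains S′)) ≤ β * m !
  codim : ∀ {S S′ : Subset n} → S′ ∈ upperCovers S → n ∸ ∣ S ∣ ≡ suc (n ∸ ∣ S′ ∣)
  codim {S} {S′} S′∈ with ∣ S′ ∣ | ∣upperCover∣ S S′∈ | ∣p∣≤n S′
  ... | _ | refl | s<n = +-∸-assoc 1 s<n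
  -- In codimension 0 there are no upper covers, since `codim` would make 0 a successor.
  covers-bound zero S eq = begin
    ∑ (upperCovers S) _      ≤⟨ ∑-bound (upperCovers S) (λ S′∈ → contradiction (trans (sym eq) (codim {S} S′∈)) λ()) ⟩
    length (upperCovers S) * 0 ≡⟨ *-zeroʳ (length (upperCovers S)) ⟩
    0                          ≤⟨ z≤n ⟩
    β * 1                      ∎
  covers-bound (suc m) S eq = begin
    ∑ (upperCovers S) _
      ≤⟨ ∑-bound (upperCovers S) (λ {S′} S′∈ → go m S′ (suc-injective (trans (sym (codim {S} S′∈)) eq))) ⟩
    length (upperCovers S) * (β * m !)
      ≡⟨ cong (_* (β * m !)) (trans (length-upperCovers S) eq) ⟩
    suc m * (β * m !)
      ≡⟨ *-swapˡ (suc m) β (m !) ⟩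
    β * suc m ! ∎

  go m S eq with S ∈? L
  ... | yes S∈L = subst (λ m → α * ∑ L (chains S) ≤ β * m !) eq (bound S∈L)
  ... | no  S∉L = begin
    α * ∑ L (chains S)
      ≡⟨ cong (α *_) (∑-cong L λ {G} G∈L → chains-upperCovers S G λ { refl → S∉L G∈L }) ⟩
    α * ∑ L (λ G → ∑ (upperCovers S) (λ S′ → chains S′ G))
      ≡⟨ cong (α *_) (∑-swap L (upperCovers S) _) ⟩
    α * ∑ (upperCovers S) (λ S′ → ∑ L (chains S′))
      ≡⟨ ∑-*ˡ α (upperCovers S) _ ⟩
    ∑ (upperCovers S) (λ S′ → α * ∑ L (chains S′))
      ≤⟨ covers-bound m S eq ⟩
    β * m ! ∎

-- Levels of a family and the chains through them

level : ℕ → List (Subset n) → List (Subset n)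
level k = filter (λ G → ∣ G ∣ ≟ k)

above : Subset n → List (Subset n) → List (Subset n)
above S = filter (S ⊆?_)

∈-level⁻ : {L : List (Subset n)} {k : ℕ} {G : Subset n} → G ∈ level k L → G ∈ L × ∣ G ∣ ≡ k
∈-level⁻ {k = k} = ∈-filter⁻ (λ G → ∣ G ∣ ≟ k)

∈-above⁻ : {L : List (Subset n)} {S G : Subset n} → G ∈ above S L → G ∈ L × S ⊆ G
∈-above⁻ {S = S} = ∈-filter⁻ (S ⊆?_)

-- Sets of equal size form an antichain, so a maximal chain meets the level at most once. In the
-- averaging argument, a member of the level sees only itself, which gives the constants
-- `α = β = 1`.
∑-chains-level : {L : List (Subset n)} → Unique L → (k : ℕ) (S : Subset n) →
  ∑ (level k L) (chains S) ≤ (n ∸ ∣ S ∣) !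
∑-chains-level {n} {L} uniq k S = begin
  ∑ (level k L) (chains S)     ≡⟨ *-identityˡ _ ⟨
  1 * ∑ (level k L) (chains S) ≤⟨ ∑-chains-bound (level k L) 1 1 only-itself _ S refl ⟩
  1 * (n ∸ ∣ S ∣) !            ≡⟨ *-identityˡ _ ⟩
  (n ∸ ∣ S ∣) !                ∎
  where
  open ≤-Reasoning
  size : ∀ {G} → G ∈ level k L → ∣ G ∣ ≡ k
  size = proj₂ ∘ ∈-level⁻ {L = L}
  only-itself : ∀ {S} → S ∈ level k L → 1 * ∑ (level k L) (chains S) ≤ 1 * (n ∸ ∣ S ∣) !
  only-itself {S} S∈ = *-monoʳ-≤ 1 (≤-trans
    (∑-single S (chains S) (Unique.filter⁺ (λ G → ∣ G ∣ ≟ k) uniq)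
      (λ {G} G∈ → chains-⊈ S G (λ S⊆G → ⊆∧∣∣≡⇒≡ S G S⊆G (trans (size S∈) (sym (size G∈))))) S∈)
    (≤-reflexive (chains-refl S)))

∑-chains-level-above : (L : List (Subset n)) (k : ℕ) (S : Subset n) →
  ∑ (level k L) (chains S) ≡ length (above S (level k L)) * ((k ∸ ∣ S ∣) ! * (n ∸ k) !)
∑-chains-level-above {n} L k S = begin
  ∑ (level k L) (chains S)
    ≡⟨ ∑-filter (S ⊆?_) (level k L) _ ⟨
  ∑ (above S (level k L)) (λ G → (∣ G ∣ ∸ ∣ S ∣) ! * (n ∸ ∣ G ∣) !)
    ≡⟨ ∑-cong (above S (level k L)) (λ {G} G∈ → cong (λ g → (g ∸ ∣ S ∣) ! * (n ∸ g) !) (size G∈)) ⟩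
  ∑ (above S (level k L)) (λ G → (k ∸ ∣ S ∣) ! * (n ∸ k) !)
    ≡⟨ ∑-const (above S (level k L)) _ ⟩
  length (above S (level k L)) * ((k ∸ ∣ S ∣) ! * (n ∸ k) !) ∎
  where
  open ≡-Reasoning
  size : ∀ {G} → G ∈ above S (level k L) → ∣ G ∣ ≡ k
  size = proj₂ ∘ ∈-level⁻ {L = L} ∘ proj₁ ∘ ∈-above⁻ {L = level k L} {S}

-- Inequalities for factorials and powers

-- Cross-multiplied form of `(k + i)! / k! ≤ (y + i)! / y!`: both quotients are products of `i`
-- factors, compared one by one.
!-convex : ∀ {k y} i → k ≤ y → (k + i) ! * y ! ≤ k ! * (y + i) !
!-convex {k} {y} zero    k≤y rewrite +-identityʳ k | +-identityʳ y = ≤-refl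
!-convex {k} {y} (suc i) k≤y rewrite +-suc k i | +-suc y i = begin
  suc (k + i) * (k + i) ! * y !     ≡⟨ *-assoc (suc (k + i)) ((k + i) !) (y !) ⟩
  suc (k + i) * ((k + i) ! * y !)   ≤⟨ *-mono-≤ (s≤s (+-monoˡ-≤ i k≤y)) (!-convex i k≤y) ⟩
  suc (y + i) * (k ! * (y + i) !)   ≡⟨ *-swapˡ (suc (y + i)) (k !) _ ⟩
  k ! * (suc (y + i) * (y + i) !)   ∎
  where
  open ≤-Reasoning

^*!≤! : ∀ t u → u ^ t * u ! ≤ (t + u) !
^*!≤! zero    u = ≤-reflexive (*-identityˡ _)
^*!≤! (suc t) u = begin
  u * u ^ t * u !         ≡⟨ *-assoc u _ _ ⟩
  u * (u ^ t * u !)       ≤⟨ *-mono-≤ (m≤n+m u (suc t)) (^*!≤! t u) ⟩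
  suc (t + u) * (t + u) ! ∎
  where open ≤-Reasoning

-- Since `r ≤ a`, the factor `1 + 1/a` is at most `1 + 1/r`; over `r, r + 1, …` these bounds
-- telescope to `(r + s) / r`.
bernoulli : ∀ a r s → r + s ≤ a → (1 + a) ^ s * r ≤ a ^ s * (r + s)
bernoulli a r zero    _     = ≤-reflexive (cong (1 *_) (sym (+-identityʳ r)))
bernoulli a r (suc s) r+s≤a = begin
  (1 + a) * (1 + a) ^ s * r       ≡⟨ e₁ a ((1 + a) ^ s) r ⟩
  (1 + a) ^ s * (r + a * r)       ≤⟨ *-monoʳ-≤ ((1 + a) ^ s) (+-monoˡ-≤ (a * r) (m+n≤o⇒m≤o r r+s≤a)) ⟩
  (1 + a) ^ s * (a + a * r)       ≡⟨ e₂ a ((1 + a) ^ s) r ⟩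
  a * ((1 + a) ^ s * suc r)       ≤⟨ *-monoʳ-≤ a (bernoulli a (suc r) s (subst (_≤ a) (+-suc r s) r+s≤a)) ⟩
  a * (a ^ s * (suc r + s))       ≡⟨ *-assoc a (a ^ s) _ ⟨
  a * a ^ s * (suc r + s)         ≡⟨ cong (a * a ^ s *_) (+-suc r s) ⟨
  a * a ^ s * (r + suc s)         ∎
  where
  open ≤-Reasoning
  e₁ : ∀ a x r → (1 + a) * x * r ≡ x * (r + a * r)
  e₁ = solve-∀
  e₂ : ∀ a x r → x * (a + a * r) ≡ a * (x * (1 + r))
  e₂ = solve-∀

^-distribʳ-* : ∀ a b s → (a * b) ^ s ≡ a ^ s * b ^ s
^-distribʳ-* a b zero    = refl
^-distribʳ-* a b (suc s) = trans (cong (a * b *_) (^-distribʳ-* a b s)) (*-interchange a b (a ^ s) (b ^ s))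

-- The hypothesis reads `n ≤ (1 + 1/(2t)) · 2u`. Taking `t`-th powers, the first factor costs at
-- most 2, whatever `t` is.
^-ratio : ∀ {t n u} → 0 < t → 2 * t * n ≤ (1 + 2 * t) * (2 * u) → n ^ t ≤ 2 * 2 ^ t * u ^ t
^-ratio {t@(suc _)} {n} {u} _ n≤u = *-cancelˡ-≤ ((2 * t) ^ t) {{m^n≢0 (2 * t) t}} (begin
  (2 * t) ^ t * n ^ t                       ≡⟨ ^-distribʳ-* (2 * t) n t ⟨
  (2 * t * n) ^ t                           ≤⟨ ^-monoˡ-≤ t n≤u ⟩
  ((1 + 2 * t) * (2 * u)) ^ t               ≡⟨ ^-distribʳ-* (1 + 2 * t) (2 * u) t ⟩
  (1 + 2 * t) ^ t * (2 * u) ^ t             ≤⟨ *-monoˡ-≤ ((2 * u) ^ t) double ⟩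
  (2 * t) ^ t * 2 * (2 * u) ^ t             ≡⟨ cong ((2 * t) ^ t * 2 *_) (^-distribʳ-* 2 u t) ⟩
  (2 * t) ^ t * 2 * (2 ^ t * u ^ t)         ≡⟨ assoc ((2 * t) ^ t) (2 ^ t) (u ^ t) ⟩
  (2 * t) ^ t * (2 * 2 ^ t * u ^ t)         ∎)
  where
  open ≤-Reasoning
  assoc : ∀ a b c → a * 2 * (b * c) ≡ a * (2 * b * c)
  assoc = solve-∀
  t+t : ∀ t → t + t ≡ 2 * t
  t+t = solve-∀
  collect : ∀ x t → x * (t + t) ≡ x * 2 * t
  collect = solve-∀
  double : (1 + 2 * t) ^ t ≤ (2 * t) ^ t * 2
  -- `bernoulli` with `a = 2t` and `r = s = t` bounds `(1 + 1/(2t))^t` by `(t + t) / t`.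
  double = *-cancelʳ-≤ _ _ t (begin
    (1 + 2 * t) ^ t * t   ≤⟨ bernoulli (2 * t) t t (≤-reflexive (t+t t)) ⟩
    (2 * t) ^ t * (t + t) ≡⟨ collect ((2 * t) ^ t) t ⟩
    (2 * t) ^ t * 2 * t   ∎)

linear-ratio : ∀ {t n u} → 0 < t → 2 * t * n ≤ (1 + 2 * t) * (2 * u) → n ≤ 3 * u
linear-ratio {t@(suc _)} {n} {u} 0<t n≤u = *-cancelˡ-≤ (2 * t) (begin
  2 * t * n               ≤⟨ n≤u ⟩
  (1 + 2 * t) * (2 * u)   ≤⟨ *-monoˡ-≤ (2 * u) (+-monoˡ-≤ (2 * t) 0<t) ⟩
  (t + 2 * t) * (2 * u)   ≡⟨ assoc t u ⟩
  2 * t * (3 * u)         ∎)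
  where
  open ≤-Reasoning
  assoc : ∀ t u → (t + 2 * t) * (2 * u) ≡ 2 * t * (3 * u)
  assoc = solve-∀

-- With a j = j! (t + u − j)!, the sum a t + a (t+1) + n a (t+2) is at most (3/2) a t.
level-weights : ∀ {t n} w → let u = 2 + w in 0 < t →
  2 * t * n ≤ (1 + 2 * t) * (2 * u) → 12 * ((1 + t) * (2 + t)) ≤ 1 + w →
  n ^ t * (t ! * u ! + ((1 + t) ! * (1 + w) ! + n * ((2 + t) ! * w !))) ≤ 3 * 2 ^ t * t ! * (t + u) !
-- The second and third weights are each at most a quarter of the first, so four times the sum is at
-- most six times the first.
level-weights {t} {n} w 0<t n≤u large = *-cancelˡ-≤ 4 (begin
  4 * (n ^ t * (t ! * u ! + (a₁ + n * a₂)))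
    ≡⟨ e₁ (n ^ t) (t ! * u !) a₁ n a₂ ⟩
  n ^ t * (4 * (t ! * u !) + (4 * a₁ + 4 * (n * a₂)))
    ≤⟨ *-monoʳ-≤ (n ^ t) (+-monoʳ-≤ (4 * (t ! * u !)) (+-mono-≤ 4a₁≤ 4na₂≤)) ⟩
  n ^ t * (4 * (t ! * u !) + (t ! * u ! + t ! * u !))
    ≡⟨ e₂ (n ^ t) (t !) (u !) ⟩
  6 * t ! * (n ^ t * u !)
    ≤⟨ *-monoʳ-≤ (6 * t !) (*-monoˡ-≤ (u !) (^-ratio 0<t n≤u)) ⟩
  6 * t ! * (2 * 2 ^ t * u ^ t * u !)
    ≡⟨ e₃ (t !) (2 ^ t) (u ^ t) (u !) ⟩
  4 * (3 * 2 ^ t * t ! * (u ^ t * u !))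
    ≤⟨ *-monoʳ-≤ 4 (*-monoʳ-≤ (3 * 2 ^ t * t !) (^*!≤! t u)) ⟩
  4 * (3 * 2 ^ t * t ! * (t + u) !) ∎)
  where
  open ≤-Reasoning
  u = 2 + w
  a₁ = (1 + t) ! * (1 + w) !
  a₂ = (2 + t) ! * w !
  e₁ : ∀ N a b n c → 4 * (N * (a + (b + n * c))) ≡ N * (4 * a + (4 * b + 4 * (n * c)))
  e₁ = solve-∀
  e₂ : ∀ N a b → N * (4 * (a * b) + (a * b + a * b)) ≡ 6 * a * (N * b)
  e₂ = solve-∀
  e₃ : ∀ a b c d → 6 * a * (2 * b * c * d) ≡ 4 * (3 * b * a * (c * d))
  e₃ = solve-∀
  e₄ : ∀ t a b → 4 * ((1 + t) * a * b) ≡ 4 * (1 + t) * (a * b)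
  e₄ = solve-∀
  e₅ : ∀ w a b → (2 + w) * (a * b) ≡ a * ((2 + w) * b)
  e₅ = solve-∀
  e₆ : ∀ n t a b → 4 * (n * ((2 + t) * ((1 + t) * a) * b)) ≡ 4 * ((1 + t) * (2 + t)) * n * (a * b)
  e₆ = solve-∀
  e₇ : ∀ t w → 4 * ((1 + t) * (2 + t)) * (3 * (2 + w)) ≡ (2 + w) * (12 * ((1 + t) * (2 + t)))
  e₇ = solve-∀
  e₈ : ∀ w a b → (2 + w) * (1 + w) * (a * b) ≡ a * ((2 + w) * ((1 + w) * b))
  e₈ = solve-∀
  4[1+t]≤u : 4 * (1 + t) ≤ u
  4[1+t]≤u = begin
    4 * (1 + t)              ≤⟨ *-mono-≤ {4} {12} (m≤m+n 4 8) (m≤m*n (1 + t) (2 + t)) ⟩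
    12 * ((1 + t) * (2 + t)) ≤⟨ large ⟩
    1 + w                    ≤⟨ n≤1+n _ ⟩
    u                        ∎
  4a₁≤ : 4 * a₁ ≤ t ! * u !
  4a₁≤ = begin
    4 * a₁                        ≡⟨ e₄ t (t !) ((1 + w) !) ⟩
    4 * (1 + t) * (t ! * (1 + w) !) ≤⟨ *-monoˡ-≤ (t ! * (1 + w) !) 4[1+t]≤u ⟩
    u * (t ! * (1 + w) !)         ≡⟨ e₅ w (t !) ((1 + w) !) ⟩
    t ! * u !                     ∎
  -- Passing from `u !` to `w !` gains `u (1 + w)`. The factor `u` pays for `n ≤ 3u`, and `1 + w`
  -- absorbs the constant `12 (1 + t) (2 + t)`.
  4na₂≤ : 4 * (n * a₂) ≤ t ! * u !
  4na₂≤ = begin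
    4 * (n * a₂)
      ≡⟨ e₆ n t (t !) (w !) ⟩
    4 * ((1 + t) * (2 + t)) * n * (t ! * w !)
      ≤⟨ *-monoˡ-≤ (t ! * w !) (*-monoʳ-≤ (4 * ((1 + t) * (2 + t))) (linear-ratio {t} {n} {u} 0<t n≤u)) ⟩
    4 * ((1 + t) * (2 + t)) * (3 * u) * (t ! * w !)
      ≡⟨ cong (_* (t ! * w !)) (e₇ t w) ⟩
    u * (12 * ((1 + t) * (2 + t))) * (t ! * w !)
      ≤⟨ *-monoˡ-≤ (t ! * w !) (*-monoʳ-≤ u large) ⟩
    u * (1 + w) * (t ! * w !)
      ≡⟨ e₈ w (t !) (w !) ⟩
    t ! * u ! ∎

-- Chains from a member with few sets above it

m≡n+o⇒m∸n≡o : ∀ {m} n {o} → m ≡ n + o → m ∸ n ≡ o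
m≡n+o⇒m∸n≡o n refl = m+n∸m≡n n _

-- With `ε = p / q`, dividing by `8 q (n ∸ ∣ S ∣) !` gives `V(S) ≤ t + 3ε/8`. The first `t` levels
-- give 1 each. On the others lightness gives the factor `δ n^t`, and `δ` times the bound
-- `3 · 2^t · t!` from `level-weights` is `3ε/8`.
∑-chains-light : {L : List (Subset n)} → Unique L → (t p q U v : ℕ) → 0 < t →
  n ≡ U + (t + (2 + v)) →
  2 * t * n ≤ (1 + 2 * t) * (2 * (2 + v)) →
  12 * ((1 + t) * (2 + t)) ≤ 1 + v →
  (∀ {G} → G ∈ L → ∣ G ∣ ≤ U) →
  (∀ {F} → F ∈ L → ∀ {k} → ∣ F ∣ + t ≤ k → k ≤ U →
    q * (length (above F (level k L)) * (2 ^ (t + 3) * t !)) ≤ p * n ^ t) →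
  ∀ {S} → S ∈ L → 8 * q * ∑ L (chains S) ≤ (8 * t * q + 3 * p) * (n ∸ ∣ S ∣) !
∑-chains-light {n} {L} uniq t p q U v 0<t n≡U+ n≤v v-large small light {S} S∈L = begin
  8 * q * ∑ L (chains S)
    ≤⟨ *-monoʳ-≤ (8 * q) (∑-fibres ∣_∣ ks L (chains S) covered) ⟩
  8 * q * ∑ ks W
    ≡⟨ cong (8 * q *_) (∑-++ (interval s t) _ W) ⟩
  8 * q * (∑ (interval s t) W + upper)
    ≡⟨ *-distribˡ-+ (8 * q) _ upper ⟩
  8 * q * ∑ (interval s t) W + 8 * q * upper
    ≤⟨ +-mono-≤ (*-monoʳ-≤ (8 * q) lower≤) upper≤ ⟩
  8 * q * (t * (n ∸ s) !) + 3 * p * (n ∸ s) !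
    ≡⟨ collect q t p ((n ∸ s) !) ⟩
  (8 * t * q + 3 * p) * (n ∸ s) ! ∎
  where
  open ≤-Reasoning
  s = ∣ S ∣
  -- Chosen so that `S` has codimension `t + (2 + w)`.
  w = v + (U ∸ s)
  W = λ k → ∑ (level k L) (chains S)
  -- The distances `t` and `t + 1` are kept apart because their weights are bounded separately. The
  -- last interval may run past `n`; its length `n` supplies the factor `n` in `level-weights`.
  ks = interval s t ++ (s + t) ∷ (s + (1 + t)) ∷ interval (s + (2 + t)) n
  upper = W (s + t) + (W (s + (1 + t)) + ∑ (interval (s + (2 + t)) n) W)
  a₂ = (2 + t) ! * w !
  c = 2 ^ (t + 3) * t !

  collect : ∀ q t p a → 8 * q * (t * a) + 3 * p * a ≡ (8 * t * q + 3 * p) * a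
  collect = solve-∀

  n≡s+ : n ≡ s + (t + (2 + w))
  n≡s+ = trans n≡U+ (trans (cong (_+ (t + (2 + v))) (sym (m+[n∸m]≡n (small S∈L)))) (assoc s (U ∸ s) t v))
    where
    assoc : ∀ s e t v → s + e + (t + (2 + v)) ≡ s + (t + (2 + (v + e)))
    assoc = solve-∀

  covered : ∀ {G} → G ∈ L → chains S G ≡ 0 ⊎ ∣ G ∣ ∈ ks
  covered {G} G∈L with S ⊆? G
  ... | no  _   = inj₁ refl
  ... | yes S⊆G = inj₂ (locate (p⊆q⇒∣p∣≤∣q∣ S⊆G))
    where
    locate : s ≤ ∣ G ∣ → ∣ G ∣ ∈ ks
    locate s≤g with <-cmp ∣ G ∣ (s + t) | <-cmp ∣ G ∣ (s + (1 + t))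
    ... | tri< g<s+t _ _ | _ = ∈-++⁺ˡ (∈-interval⁺ s≤g g<s+t)
    ... | tri≈ _ g≡s+t _ | _ = ∈-++⁺ʳ (interval s t) (here g≡s+t)
    ... | _ | tri≈ _ g≡s+1+t _ = ∈-++⁺ʳ (interval s t) (there (here g≡s+1+t))
    ... | tri> _ _ g>s+t | tri< g<s+1+t _ _ =
      contradiction (<-≤-trans g<s+1+t (≤-reflexive (+-suc s t))) (≤⇒≯ g>s+t)
    ... | _ | tri> _ _ g>s+1+t = ∈-++⁺ʳ (interval s t) (there (there (∈-interval⁺
      (≤-trans (≤-reflexive (+-suc s (1 + t))) g>s+1+t)
      (≤-trans (s≤s (∣p∣≤n G)) (+-monoˡ-≤ n (≤-trans (s≤s z≤n) (≤-reflexive (sym (+-suc s (1 + t))))))))))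

  lower≤ : ∑ (interval s t) W ≤ t * (n ∸ s) !
  lower≤ = ≤-trans (∑-bound (interval s t) (λ {k} _ → ∑-chains-level uniq k S))
                   (≤-reflexive (cong (_* (n ∸ s) !) (length-interval s t)))

  level≤ : ∀ j b → t ≤ j → (s + j ≤ U → j ! * (n ∸ (s + j)) ! ≤ b) → q * c * W (s + j) ≤ p * n ^ t * b
  level≤ j b t≤j weight≤b with s + j ≤? U
  ... | yes k≤U = begin
    q * c * W (s + j)
      ≡⟨ cong (q * c *_) (∑-chains-level-above L (s + j) S) ⟩
    q * c * (ℓ * ((s + j ∸ s) ! * (n ∸ (s + j)) !))
      ≡⟨ cong (λ i → q * c * (ℓ * (i ! * (n ∸ (s + j)) !))) (m+n∸m≡n s j) ⟩
    q * c * (ℓ * (j ! * (n ∸ (s + j)) !))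
      ≡⟨ assoc q c ℓ _ ⟩
    q * (ℓ * c) * (j ! * (n ∸ (s + j)) !)
      ≤⟨ *-mono-≤ (light S∈L (+-monoʳ-≤ s t≤j) k≤U) (weight≤b k≤U) ⟩
    p * n ^ t * b ∎
    where
    ℓ = length (above S (level (s + j) L))
    assoc : ∀ q c l a → q * c * (l * a) ≡ q * (l * c) * a
    assoc = solve-∀
  -- A level above `U` is empty, as all members have size at most `U`.
  ... | no k≰U = begin
    q * c * W (s + j) ≡⟨ cong (q * c *_) (∑-zero (level (s + j) L) (λ G∈ → contradiction (too-big G∈) k≰U)) ⟩
    q * c * 0         ≡⟨ *-zeroʳ (q * c) ⟩
    0                 ≤⟨ z≤n ⟩
    p * n ^ t * b     ∎
    where
    too-big : ∀ {G} → G ∈ level (s + j) L → s + j ≤ U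
    too-big G∈ with ∈-level⁻ {L = L} G∈
    ... | G∈L , ∣G∣≡s+j = ≤-trans (≤-reflexive (sym ∣G∣≡s+j)) (small G∈L)

  far≤ : ∀ {k} → k ∈ interval (s + (2 + t)) n → q * c * W k ≤ p * n ^ t * a₂
  far≤ {k} k∈ = subst (λ k → q * c * W k ≤ p * n ^ t * a₂) k≡
    (level≤ (2 + t + i) a₂ (≤-trans (m≤n+m t 2) (m≤m+n (2 + t) i)) weight)
    where
    i = k ∸ (s + (2 + t))
    k≡ : s + (2 + t + i) ≡ k
    k≡ = trans (sym (+-assoc s (2 + t) i)) (m+[n∸m]≡n (∈-interval⁻ k∈))
    -- A size at most `U` leaves codimension at least `2 + t`, so by convexity of the factorial no
    -- weight `j! (m - j)!` in this range exceeds the one at `j = 2 + t`.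
    weight : s + (2 + t + i) ≤ U → (2 + t + i) ! * (n ∸ (s + (2 + t + i))) ! ≤ a₂
    weight k≤U = begin
      (2 + t + i) ! * y !     ≤⟨ !-convex i 2+t≤y ⟩
      (2 + t) ! * (y + i) !   ≡⟨ cong (λ x → (2 + t) ! * x !) y+i≡w ⟩
      (2 + t) ! * w !         ∎
      where
      y = n ∸ (s + (2 + t + i))
      2+t≤y : 2 + t ≤ y
      2+t≤y = m+n≤o⇒m≤o∸n (2 + t) (begin
        2 + t + (s + (2 + t + i)) ≤⟨ +-monoʳ-≤ (2 + t) k≤U ⟩
        2 + t + U                 ≤⟨ m≤m+n _ v ⟩
        2 + t + U + v             ≡⟨ shuffle t U v ⟩
        U + (t + (2 + v))         ≡⟨ n≡U+ ⟨
        n                         ∎)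
        where
        shuffle : ∀ t U v → 2 + t + U + v ≡ U + (t + (2 + v))
        shuffle = solve-∀
      k≤n : s + (2 + t + i) ≤ n
      k≤n = ≤-trans k≤U (≤-trans (m≤m+n U _) (≤-reflexive (sym n≡U+)))
      y+i≡w : y + i ≡ w
      y+i≡w = +-cancelˡ-≡ (s + (2 + t)) (y + i) w (begin-equality
        s + (2 + t) + (y + i)       ≡⟨ shuffle₁ s t y i ⟩
        s + (2 + t + i) + y         ≡⟨ m+[n∸m]≡n k≤n ⟩
        n                           ≡⟨ n≡s+ ⟩
        s + (t + (2 + w))           ≡⟨ shuffle₂ s t w ⟩
        s + (2 + t) + w             ∎)
        where
        shuffle₁ : ∀ s t y i → s + (2 + t) + (y + i) ≡ s + (2 + t + i) + y
        shuffle₁ = solve-∀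
        shuffle₂ : ∀ s t w → s + (t + (2 + w)) ≡ s + (2 + t) + w
        shuffle₂ = solve-∀

  n∸[s+t] : n ∸ (s + t) ≡ 2 + w
  n∸[s+t] = m≡n+o⇒m∸n≡o (s + t) (trans n≡s+ (sym (+-assoc s t (2 + w))))

  n∸[s+1+t] : n ∸ (s + (1 + t)) ≡ 1 + w
  n∸[s+1+t] = m≡n+o⇒m∸n≡o (s + (1 + t)) (trans n≡s+ (shuffle s t w))
    where
    shuffle : ∀ s t w → s + (t + (2 + w)) ≡ s + (1 + t) + (1 + w)
    shuffle = solve-∀

  qc-upper≤ : q * c * upper ≤ p * n ^ t * (t ! * (2 + w) ! + ((1 + t) ! * (1 + w) ! + n * a₂))
  qc-upper≤ = begin
    q * c * upper
      ≡⟨ distrib (q * c) _ _ _ ⟩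
    q * c * W (s + t) + (q * c * W (s + (1 + t)) + q * c * ∑ (interval (s + (2 + t)) n) W)
      ≤⟨ +-mono-≤ (level≤ t _ ≤-refl λ _ → ≤-reflexive (cong (λ x → t ! * x !) n∸[s+t]))
        (+-mono-≤ (level≤ (1 + t) _ (n≤1+n t) λ _ → ≤-reflexive (cong (λ x → (1 + t) ! * x !) n∸[s+1+t])) far) ⟩
    P * (t ! * (2 + w) !) + (P * ((1 + t) ! * (1 + w) !) + P * (n * a₂))
      ≡⟨ distrib P _ _ _ ⟨
    P * (t ! * (2 + w) ! + ((1 + t) ! * (1 + w) ! + n * a₂)) ∎
    where
    P = p * n ^ t
    distrib : ∀ k a b c → k * (a + (b + c)) ≡ k * a + (k * b + k * c)
    distrib = solve-∀
    far : q * c * ∑ (interval (s + (2 + t)) n) W ≤ P * (n * a₂)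
    far = begin
      q * c * ∑ (interval (s + (2 + t)) n) W         ≡⟨ ∑-*ˡ (q * c) (interval (s + (2 + t)) n) W ⟩
      ∑ (interval (s + (2 + t)) n) (λ k → q * c * W k) ≤⟨ ∑-bound (interval (s + (2 + t)) n) far≤ ⟩
      length (interval (s + (2 + t)) n) * (P * a₂)   ≡⟨ cong (_* (P * a₂)) (length-interval (s + (2 + t)) n) ⟩
      n * (P * a₂)                                   ≡⟨ *-swapˡ n P a₂ ⟩
      P * (n * a₂)                                   ∎

  upper≤ : 8 * q * upper ≤ 3 * p * (n ∸ s) !
  upper≤ = *-cancelˡ-≤ (2 ^ t * t !) {{m*n≢0 (2 ^ t) (t !) {{m^n≢0 2 t}} {{t !≢0}}}} (begin
    2 ^ t * t ! * (8 * q * upper)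
      ≡⟨ e₁ (2 ^ t) (t !) q upper ⟩
    q * (2 ^ t * 8 * t !) * upper
      ≡⟨ cong (λ x → q * (x * t !) * upper) (^-distribˡ-+-* 2 t 3) ⟨
    q * c * upper
      ≤⟨ qc-upper≤ ⟩
    p * n ^ t * (t ! * (2 + w) ! + ((1 + t) ! * (1 + w) ! + n * a₂))
      ≡⟨ *-assoc p _ _ ⟩
    p * (n ^ t * (t ! * (2 + w) ! + ((1 + t) ! * (1 + w) ! + n * a₂)))
      ≤⟨ *-monoʳ-≤ p (level-weights w 0<t
           (≤-trans n≤v (*-monoʳ-≤ (1 + 2 * t) (*-monoʳ-≤ 2 (+-monoʳ-≤ 2 (m≤m+n v _)))))
           (≤-trans v-large (s≤s (m≤m+n v _)))) ⟩
    p * (3 * 2 ^ t * t ! * (t + (2 + w)) !)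
      ≡⟨ cong (λ x → p * (3 * 2 ^ t * t ! * x !)) (m≡n+o⇒m∸n≡o s n≡s+) ⟨
    p * (3 * 2 ^ t * t ! * (n ∸ s) !)
      ≡⟨ e₂ (2 ^ t) (t !) p ((n ∸ s) !) ⟩
    2 ^ t * t ! * (3 * p * (n ∸ s) !) ∎)
    where
    e₁ : ∀ a b q u → a * b * (8 * q * u) ≡ q * (a * 8 * b) * u
    e₁ = solve-∀
    e₂ : ∀ a b p m → p * (3 * a * b * m) ≡ a * b * (3 * p * m)
    e₂ = solve-∀

-- Binomial coefficients: the central maximum and the decay beyond it

C-! : ∀ {n k} → k ≤ n → (n C k) * (k ! * (n ∸ k) !) ≡ n !
C-! {n} {k} k≤n = trans (cong (_* (k ! * (n ∸ k) !)) (nCk≡n!/k![n-k]! k≤n)) (m/n*n≡m {{k !* (n ∸ k) !≢0}} (k![n∸k]!∣n! k≤n))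

C*≤⇒≤ : ∀ {n k a b} → k ≤ n → a * (k ! * (n ∸ k) !) ≤ b * (k ! * (n ∸ k) !) → a ≤ b
C*≤⇒≤ {n} {k} _ = *-cancelʳ-≤ _ _ (k ! * (n ∸ k) !) {{k !* (n ∸ k) !≢0}}

h+h≡h*2 : ∀ h → h + h ≡ h * 2
h+h≡h*2 = solve-∀

n/2+n/2≤n : ∀ n → n / 2 + n / 2 ≤ n
n/2+n/2≤n n = ≤-trans (≤-reflexive (h+h≡h*2 (n / 2))) (m/n*n≤m n 2)

n≤1+n/2+n/2 : ∀ n → n ≤ suc (n / 2 + n / 2)
n≤1+n/2+n/2 n = begin
  n                       ≡⟨ m≡m%n+[m/n]*n n 2 ⟩
  n % 2 + n / 2 * 2       ≤⟨ +-monoˡ-≤ (n / 2 * 2) (s≤s⁻¹ (m%n<n n 2)) ⟩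
  suc (n / 2 * 2)         ≡⟨ cong suc (h+h≡h*2 (n / 2)) ⟨
  suc (n / 2 + n / 2)     ∎
  where
  open ≤-Reasoning

-- Moving factors between the two factorials towards balance lowers the product, by `!-convex`; for
-- `k` above the middle the roles of `k` and `n ∸ k` are exchanged. Besides maximality of the
-- central coefficient, this says that every set lies on at least as many maximal chains as a middle
-- one.
central-! : ∀ {n k} → k ≤ n → (n / 2) ! * (n ∸ n / 2) ! ≤ k ! * (n ∸ k) !
central-! {n} {k} k≤n with <-cmp k (n / 2)
... | tri≈ _ refl _ = ≤-refl
... | tri< k<h _ _ = begin
  h ! * (n ∸ h) !               ≡⟨ cong (λ x → x ! * (n ∸ h) !) (m+[n∸m]≡n (<⇒≤ k<h)) ⟨
  (k + (h ∸ k)) ! * (n ∸ h) !   ≤⟨ !-convex (h ∸ k) (≤-trans (<⇒≤ k<h) (m+n≤o⇒m≤o∸n h (n/2+n/2≤n n))) ⟩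
  k ! * (n ∸ h + (h ∸ k)) !     ≡⟨ cong (λ x → k ! * x !) (+-∸-assoc (n ∸ h) (<⇒≤ k<h)) ⟨
  k ! * (n ∸ h + h ∸ k) !       ≡⟨ cong (λ x → k ! * (x ∸ k) !) (m∸n+n≡m (m+n≤o⇒m≤o h (n/2+n/2≤n n))) ⟩
  k ! * (n ∸ k) !               ∎
  where
  open ≤-Reasoning
  h = n / 2
... | tri> _ _ h<k = begin
  h ! * (n ∸ h) !               ≡⟨ *-comm (h !) _ ⟩
  (n ∸ h) ! * h !               ≡⟨ cong (λ x → x ! * h !) n∸h≡ ⟩
  (n ∸ k + (k ∸ h)) ! * h !     ≤⟨ !-convex (k ∸ h) n∸k≤h ⟩
  (n ∸ k) ! * (h + (k ∸ h)) !   ≡⟨ cong (λ x → (n ∸ k) ! * x !) (m+[n∸m]≡n (<⇒≤ h<k)) ⟩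
  (n ∸ k) ! * k !               ≡⟨ *-comm ((n ∸ k) !) _ ⟩
  k ! * (n ∸ k) !               ∎
  where
  open ≤-Reasoning
  h = n / 2
  n∸h≡ : n ∸ h ≡ n ∸ k + (k ∸ h)
  n∸h≡ = trans (cong (_∸ h) (sym (m∸n+n≡m k≤n))) (+-∸-assoc (n ∸ k) (<⇒≤ h<k))
  n∸k≤h : n ∸ k ≤ h
  n∸k≤h = m≤n+o⇒m∸n≤o n k (≤-trans (n≤1+n/2+n/2 n) (+-monoˡ-≤ h h<k))

C≤central : ∀ {n k} → k ≤ n → n C k ≤ n C (n / 2)
C≤central {n} {k} k≤n = C*≤⇒≤ k≤n (begin
  (n C k) * (k ! * (n ∸ k) !)             ≡⟨ C-! k≤n ⟩
  n !                                     ≡⟨ C-! (m/n≤m n 2) ⟨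
  (n C (n / 2)) * ((n / 2) ! * (n ∸ n / 2) !) ≤⟨ *-monoʳ-≤ (n C (n / 2)) (central-! k≤n) ⟩
  (n C (n / 2)) * (k ! * (n ∸ k) !)       ∎)
  where open ≤-Reasoning

C-suc : ∀ {n k} → k < n → (n C suc k) * suc k ≡ (n C k) * (n ∸ k)
C-suc {n} {k} k<n = *-cancelʳ-≡ _ _ (k ! * (n ∸ suc k) !) {{k !* (n ∸ suc k) !≢0}} (begin
  (n C suc k) * suc k * (k ! * r)      ≡⟨ e₁ (n C suc k) (suc k) (k !) r ⟩
  (n C suc k) * (suc k * k ! * r)      ≡⟨ C-! k<n ⟩
  n !                                  ≡⟨ C-! (<⇒≤ k<n) ⟨
  (n C k) * (k ! * (n ∸ k) !)          ≡⟨ cong (λ x → (n C k) * (k ! * x !)) n∸k≡ ⟩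
  (n C k) * (k ! * (suc (n ∸ suc k) * r)) ≡⟨ e₂ (n C k) (k !) (suc (n ∸ suc k)) r ⟩
  (n C k) * suc (n ∸ suc k) * (k ! * r) ≡⟨ cong (λ x → (n C k) * x * (k ! * r)) n∸k≡ ⟨
  (n C k) * (n ∸ k) * (k ! * r)        ∎)
  where
  open ≡-Reasoning
  r = (n ∸ suc k) !
  n∸k≡ : n ∸ k ≡ suc (n ∸ suc k)
  n∸k≡ = +-∸-assoc 1 k<n
  e₁ : ∀ a b c d → a * b * (c * d) ≡ a * (b * c * d)
  e₁ = solve-∀
  e₂ : ∀ a b c d → a * (b * (c * d)) ≡ a * c * (b * d)
  e₂ = solve-∀

-- Equivalently, (n choose j+1) / (n choose j) ≤ b / (b + 1) for all j ≥ k.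
record DecayFrom (n b k : ℕ) : Set where
  constructor mkDecay
  field ratio : suc b * (n ∸ k) ≤ b * suc k
open DecayFrom

decay-+ : ∀ {n b k} i → DecayFrom n b k → DecayFrom n b (k + i)
decay-+ {n} {b} {k} i decay = mkDecay (begin
  suc b * (n ∸ (k + i)) ≤⟨ *-monoʳ-≤ (suc b) (∸-monoʳ-≤ n (m≤m+n k i)) ⟩
  suc b * (n ∸ k)       ≤⟨ ratio decay ⟩
  b * suc k             ≤⟨ *-monoʳ-≤ b (s≤s (m≤m+n k i)) ⟩
  b * suc (k + i)       ∎)
  where open ≤-Reasoning

decay-step : ∀ {n b k} → DecayFrom n b k → suc b * (n C suc k) ≤ b * (n C k)
decay-step {n} {b} {k} decay with <-≤-connex k n
... | inj₂ n≤k = ≤-trans (≤-reflexive (trans (cong (suc b *_) (k>n⇒nCk≡0 (s≤s n≤k))) (*-zeroʳ (suc b)))) z≤n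
... | inj₁ k<n = *-cancelʳ-≤ _ _ (suc k) (begin
  suc b * (n C suc k) * suc k     ≡⟨ *-assoc (suc b) (n C suc k) (suc k) ⟩
  suc b * ((n C suc k) * suc k)   ≡⟨ cong (suc b *_) (C-suc k<n) ⟩
  suc b * ((n C k) * (n ∸ k))     ≡⟨ *-swapˡ (suc b) (n C k) (n ∸ k) ⟩
  (n C k) * (suc b * (n ∸ k))     ≤⟨ *-monoʳ-≤ (n C k) (ratio decay) ⟩
  (n C k) * (b * suc k)           ≡⟨ assoc (n C k) b (suc k) ⟩
  b * (n C k) * suc k             ∎)
  where
  open ≤-Reasoning
  assoc : ∀ a b c → a * (b * c) ≡ b * a * c
  assoc = solve-∀

-- The geometric decay (b / (b + 1))^i is weakened to b / (b + i).
C-decay : ∀ {n b k} → DecayFrom n b k → ∀ i → (b + i) * (n C (k + i)) ≤ b * (n C k)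
C-decay {n} {b} {k} decay zero rewrite +-identityʳ b | +-identityʳ k = ≤-refl
C-decay {n} {b} {k} decay (suc i) = *-cancelˡ-≤ (suc b) (begin
  suc b * ((b + suc i) * (n C (k + suc i))) ≡⟨ cong (λ x → suc b * ((b + suc i) * (n C x))) (+-suc k i) ⟩
  suc b * ((b + suc i) * (n C suc (k + i))) ≡⟨ *-swapˡ (suc b) (b + suc i) _ ⟩
  (b + suc i) * (suc b * (n C suc (k + i))) ≤⟨ *-monoʳ-≤ (b + suc i) (decay-step (decay-+ i decay)) ⟩
  (b + suc i) * (b * (n C (k + i)))         ≡⟨ e₁ b i (n C (k + i)) ⟩
  -- Adding `i` completes `b (b + i + 1)` to the product `(b + 1) (b + i)`.
  (b * suc i + b * b) * (n C (k + i))       ≤⟨ *-monoˡ-≤ (n C (k + i)) (m≤m+n (b * suc i + b * b) i) ⟩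
  (b * suc i + b * b + i) * (n C (k + i))   ≡⟨ e₂ b i (n C (k + i)) ⟩
  suc b * ((b + i) * (n C (k + i)))         ≤⟨ *-monoʳ-≤ (suc b) (C-decay decay i) ⟩
  suc b * (b * (n C k))                     ∎)
  where
  open ≤-Reasoning
  e₁ : ∀ b i x → (b + (1 + i)) * (b * x) ≡ (b * (1 + i) + b * b) * x
  e₁ = solve-∀
  e₂ : ∀ b i x → (b * (1 + i) + b * b + i) * x ≡ (1 + b) * ((b + i) * x)
  e₂ = solve-∀

-- A geometric series of ratio `b / (b + 1)` whose sum is `b` times the term preceding it: the head
-- and `b` times the head make `b + 1` heads, which `decay-step` bounds.
C-tail : ∀ {n b u} → DecayFrom n b u → ∀ l → ∑ (interval (suc u) l) (n C_) ≤ b * (n C u)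
C-tail                 decay zero    = z≤n
C-tail {n} {b} {u} decay (suc l) = begin
  (n C suc u) + ∑ (interval (2 + u) l) (n C_) ≤⟨ +-monoʳ-≤ (n C suc u) (C-tail decay′ l) ⟩
  suc b * (n C suc u)                         ≤⟨ decay-step decay ⟩
  b * (n C u)                                 ∎
  where
  open ≤-Reasoning
  decay′ : DecayFrom n b (suc u)
  decay′ = subst (DecayFrom n b) (+-comm u 1) (decay-+ 1 decay)

-- Bounds on levels and on families of large sets

chains-⊥ : (G : Subset n) → chains ⊥ G ≡ ∣ G ∣ ! * (n ∸ ∣ G ∣) !
chains-⊥ {n} G with ⊥ ⊆? G
... | yes _   = cong (λ s → (∣ G ∣ ∸ s) ! * (n ∸ ∣ G ∣) !) (∣⊥∣≡0 n)
... | no  ⊥⊈G = ⊥-elim (⊥⊈G λ x∈⊥ → ⊥⊆ x∈⊥)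

length≡∑1 : (xs : List A) → length xs ≡ ∑ xs (λ _ → 1)
length≡∑1 xs = sym (trans (∑-const xs 1) (*-identityʳ _))

-- Each `k`-set lies on `k! (n - k)!` of the `n!` maximal chains, and no chain contains two of them.
length-level≤C : {L : List (Subset n)} → Unique L → ∀ k → length (level k L) ≤ n C k
length-level≤C {n} {L} uniq k with <-≤-connex n k
... | inj₁ n<k = ≤-trans (≤-reflexive (trans (length≡∑1 (level k L)) (∑-zero (level k L) too-big))) z≤n
  where
  too-big : ∀ {G} → G ∈ level k L → 1 ≡ 0
  too-big {G} G∈ = contradiction n<k
    (≤⇒≯ (subst (_≤ n) (proj₂ (∈-level⁻ {L = L} G∈)) (∣p∣≤n G)))
... | inj₂ k≤n = C*≤⇒≤ k≤n (begin
  length (level k L) * (k ! * (n ∸ k) !)          ≡⟨ ∑-const (level k L) _ ⟨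
  ∑ (level k L) (λ _ → k ! * (n ∸ k) !)           ≡⟨ ∑-cong (level k L) (λ {G} G∈ → sym (trans (chains-⊥ G) (cong (λ g → g ! * (n ∸ g) !) (size G∈)))) ⟩
  ∑ (level k L) (chains ⊥)                        ≤⟨ ∑-chains-level uniq k ⊥ ⟩
  (n ∸ ∣ ⊥ {n} ∣) !                               ≡⟨ cong (λ s → (n ∸ s) !) (∣⊥∣≡0 n) ⟩
  n !                                             ≡⟨ C-! k≤n ⟨
  (n C k) * (k ! * (n ∸ k) !)                     ∎)
  where
  open ≤-Reasoning
  size : ∀ {G} → G ∈ level k L → ∣ G ∣ ≡ k
  size = proj₂ ∘ ∈-level⁻ {L = L}

length-large≤ : ∀ {b U} {L : List (Subset n)} → Unique L → DecayFrom n b U →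
  (∀ {G} → G ∈ L → U < ∣ G ∣) → length L ≤ b * (n C U)
length-large≤ {n} {b} {U} {L} uniq decay large = begin
  length L
    ≡⟨ length≡∑1 L ⟩
  ∑ L (λ _ → 1)
    ≤⟨ ∑-fibres ∣_∣ (interval (suc U) n) L _ (λ {G} G∈ → inj₂ (∈-interval⁺ (large G∈) (s≤s (≤-trans (∣p∣≤n G) (m≤n+m n U))))) ⟩
  ∑ (interval (suc U) n) (λ k → ∑ (level k L) (λ _ → 1))
    ≤⟨ ∑-mono (interval (suc U) n) (λ {k} _ → ≤-trans (≤-reflexive (sym (length≡∑1 (level k L)))) (length-level≤C uniq k)) ⟩
  ∑ (interval (suc U) n) (n C_)
    ≤⟨ C-tail decay n ⟩
  b * (n C U) ∎
  where open ≤-Reasoning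

length-filter-split : {P : A → Set} (P? : Decidable P) (xs : List A) →
  length xs ≡ length (filter P? xs) + length (filter (¬? ∘ P?) xs)
length-filter-split P? []       = refl
length-filter-split P? (x ∷ xs) with does (P? x)
... | true  = cong suc (length-filter-split P? xs)
... | false = trans (cong suc (length-filter-split P? xs)) (sym (+-suc _ _))

-- A member with many sets above it on one level

-- With `ε = p / q`, the second component says that at least `δ n^t` members of size `k` contain
-- `F`, multiplied out.
Rich : (t p q : ℕ) → List (Subset n) → Subset n → ℕ → Set
Rich {n} t p q L F k =
  ∣ F ∣ + t ≤ k × p * n ^ t ≤ q * (length (above F (level k L)) * (2 ^ (t + 3) * t !))

-- Without a rich pair every member is light, so averaging down to `⊥` gives `V(∅) ≤ t + 3ε/8`. But
-- each member lies on at least as many chains as a middle set, so the size of `L` forces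
-- `V(∅) ≥ t + ε/2`.
∃-rich : {L : List (Subset n)} → Unique L → (t p q U v : ℕ) → 0 < t → 0 < p →
  n ≡ U + (t + (2 + v)) →
  2 * t * n ≤ (1 + 2 * t) * (2 * (2 + v)) →
  12 * ((1 + t) * (2 + t)) ≤ 1 + v →
  (∀ {G} → G ∈ L → ∣ G ∣ ≤ U) →
  (8 * t * q + 4 * p) * (n C (n / 2)) ≤ 8 * q * length L →
  ∃ λ F → ∃ λ k → F ∈ L × Rich t p q L F k
∃-rich {n} {L} uniq t p q U v 0<t 0<p n≡U+ n≤v v-large small many
  -- The search over `F` in `L` and `k ≤ n` is finite and decidable, so refuting its failure
  -- produces a witness.
  with any? (λ F → any? (λ k →
    (∣ F ∣ + t ≤? k) ×-dec (p * n ^ t ≤? q * (length (above F (level k L)) * (2 ^ (t + 3) * t !))))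
    (interval 0 (suc n))) L
... | yes found = let F , F∈L , found′ = find found ; k , _ , rich = find found′ in F , k , F∈L , rich
... | no ∄rich = contradiction (*-cancelʳ-≤ _ _ (n !) {{n !≢0}} too-many)
  (<⇒≱ (+-monoʳ-< (8 * t * q) (*-monoˡ-< p {{>-nonZero 0<p}} (n<1+n 3))))
  where
  open ≤-Reasoning
  h = n / 2
  light : ∀ {F} → F ∈ L → ∀ {k} → ∣ F ∣ + t ≤ k → k ≤ U →
    q * (length (above F (level k L)) * (2 ^ (t + 3) * t !)) ≤ p * n ^ t
  light F∈L {k} far k≤U = ≰⇒≥ λ rich → ∄rich (lose F∈L (lose
    (∈-interval⁺ z≤n (s≤s (≤-trans k≤U (≤-trans (m≤m+n U _) (≤-reflexive (sym n≡U+)))))) (far , rich)))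
  too-many : (8 * t * q + 4 * p) * n ! ≤ (8 * t * q + 3 * p) * n !
  too-many = begin
    (8 * t * q + 4 * p) * n !
      ≡⟨ cong ((8 * t * q + 4 * p) *_) (C-! (m/n≤m n 2)) ⟨
    (8 * t * q + 4 * p) * ((n C h) * (h ! * (n ∸ h) !))
      ≡⟨ *-assoc (8 * t * q + 4 * p) (n C h) _ ⟨
    (8 * t * q + 4 * p) * (n C h) * (h ! * (n ∸ h) !)
      ≤⟨ *-monoˡ-≤ (h ! * (n ∸ h) !) many ⟩
    8 * q * length L * (h ! * (n ∸ h) !)
      ≡⟨ *-assoc (8 * q) (length L) _ ⟩
    8 * q * (length L * (h ! * (n ∸ h) !))
      ≡⟨ cong (8 * q *_) (∑-const L _) ⟨
    8 * q * ∑ L (λ _ → h ! * (n ∸ h) !)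
      ≤⟨ *-monoʳ-≤ (8 * q) (∑-mono L λ {G} _ → ≤-trans (central-! (∣p∣≤n G)) (≤-reflexive (sym (chains-⊥ G)))) ⟩
    8 * q * ∑ L (chains ⊥)
      ≤⟨ ∑-chains-bound L (8 * q) (8 * t * q + 3 * p)
           (∑-chains-light uniq t p q U v 0<t n≡U+ n≤v v-large small light)
           n ⊥ (cong (n ∸_) (∣⊥∣≡0 n)) ⟩
    (8 * t * q + 3 * p) * n ! ∎

-- From one level to an induced copy of the poset

incomparable-level : {Gs : List (Subset n)} {k : ℕ} → Unique Gs → (∀ {G} → G ∈ Gs → ∣ G ∣ ≡ k) →
  AllPairs Incomparable Gs
incomparable-level []             size = []
incomparable-level (x∉ ∷ uniq) size =
  All.tabulate (λ {H} H∈ → let x≢H = All.lookup x∉ H∈ ; ∣x∣≡∣H∣ = trans (size (here refl)) (sym (size (there H∈))) in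
    (λ x⊆H → x≢H (⊆∧∣∣≡⇒≡ _ _ x⊆H ∣x∣≡∣H∣)) , (λ H⊆x → x≢H (sym (⊆∧∣∣≡⇒≡ _ _ H⊆x (sym ∣x∣≡∣H∣)))))
  ∷ incomparable-level uniq (size ∘ there)

vee : (𝓕 : Family n) {L : List (Subset n)} → Unique L → (∀ {G} → G ∈ L → G ∈ sets 𝓕) →
  ∀ {F k} → ∣ F ∣ < k → InducedVeeAbove 𝓕 F (above F (level k L))
vee 𝓕 {L} uniq L⊆𝓕 {F} {k} F<k =
  All.tabulate (λ {G} G∈ →
    let G∈level , F⊆G = ∈-above⁻ {L = level k L} {F} G∈
        G∈L , ∣G∣≡k = ∈-level⁻ {L = L} G∈level in
    L⊆𝓕 G∈L , ⊆∧∣∣<⇒⊂ F G F⊆G (≤-trans F<k (≤-reflexive (sym ∣G∣≡k)))) ,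
  incomparable-level (Unique.filter⁺ (F ⊆?_) (Unique.filter⁺ (λ G → ∣ G ∣ ≟ k) uniq))
    (proj₂ ∘ ∈-level⁻ {L = L} ∘ proj₁ ∘ ∈-above⁻ {L = level k L} {F})

-- Truncation: the sets lost and the choice of cutoff

-- The `i` levels after the onset shrink the coefficient by `b / (b + i)`, and the tail beyond them
-- costs a factor `b`. The loss is thus at most `b² / (b + i)` central coefficients, which `i-large`
-- makes at most `ε/2`.
large≤ : ∀ {b k i p q} {L : List (Subset n)} → Unique L → DecayFrom n b k → k ≤ n → 0 < b + i →
  2 * q * (b * b) ≤ p * (b + i) → (∀ {G} → G ∈ L → k + i < ∣ G ∣) →
  2 * q * length L ≤ p * (n C (n / 2))
large≤ {n} {b} {k} {i} {p} {q} {L} uniq decay k≤n 0<b+i i-large large =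
  *-cancelˡ-≤ (b + i) {{>-nonZero 0<b+i}} (begin
    (b + i) * (2 * q * length L)
      ≤⟨ *-monoʳ-≤ (b + i) (*-monoʳ-≤ (2 * q) (length-large≤ uniq (decay-+ i decay) large)) ⟩
    (b + i) * (2 * q * (b * (n C (k + i))))
      ≡⟨ e₁ b i q (n C (k + i)) ⟩
    2 * q * b * ((b + i) * (n C (k + i)))
      ≤⟨ *-monoʳ-≤ (2 * q * b) (C-decay decay i) ⟩
    2 * q * b * (b * (n C k))
      ≤⟨ *-monoʳ-≤ (2 * q * b) (*-monoʳ-≤ b (C≤central k≤n)) ⟩
    2 * q * b * (b * (n C (n / 2)))
      ≡⟨ e₂ b q (n C (n / 2)) ⟩
    2 * q * (b * b) * (n C (n / 2))
      ≤⟨ *-monoˡ-≤ (n C (n / 2)) i-large ⟩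
    p * (b + i) * (n C (n / 2))
      ≡⟨ e₃ p (b + i) (n C (n / 2)) ⟩
    (b + i) * (p * (n C (n / 2))) ∎)
  where
  open ≤-Reasoning
  e₁ : ∀ b i q c → (b + i) * (2 * q * (b * c)) ≡ 2 * q * b * ((b + i) * c)
  e₁ = solve-∀
  e₂ : ∀ b q c → 2 * q * b * (b * c) ≡ 2 * q * (b * b) * c
  e₂ = solve-∀
  e₃ : ∀ p x c → p * x * c ≡ x * (p * c)
  e₃ = solve-∀

module Cutoff (t i n : ℕ) where
  base = 4 * (1 + 2 * t)
  onset = n / 2 + n / base
  cutoff = onset + i
  slack = n ∸ (cutoff + t)
  -- The summands serve, in order, `cutoff-bound`, the lower bound on `slack`, and the positivity of
  -- `n / base`.
  threshold = base * (i + t) + 3 * (1 + 12 * ((1 + t) * (2 + t))) + base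

  module _ (0<t : 0 < t) (N≤n : threshold ≤ n) where
    open ≤-Reasoning

    base-term : base * (i + t) ≤ n
    base-term = m+n≤o⇒m≤o _ (m+n≤o⇒m≤o _ N≤n)

    base≤n : base ≤ n
    base≤n = m+n≤o⇒n≤o _ N≤n

    -- Twice `n / 2` takes `(1 + 2t) n` of the right side, and after `2 t n` a budget of `n`
    -- remains: the choice of `base` lets `n / base` use at most half of it, and `i + t` at most the
    -- other half. The additive form also yields `cutoff+t≤n`.
    cutoff-bound : (1 + 2 * t) * (2 * (cutoff + t)) + 2 * t * n ≤ (1 + 2 * t) * (2 * n)
    cutoff-bound = *-cancelˡ-≤ 2 (begin
      2 * ((1 + 2 * t) * (2 * (cutoff + t)) + 2 * t * n)
        ≡⟨ e₁ t (n / 2) (n / base) i n ⟩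
      (1 + 2 * t) * (2 * (n / 2 + n / 2)) + (n / base) * base + (base * (i + t) + 4 * t * n)
        ≤⟨ +-mono-≤ (+-mono-≤ (*-monoʳ-≤ (1 + 2 * t) (*-monoʳ-≤ 2 (n/2+n/2≤n n))) (m/n*n≤m n base)) (+-monoˡ-≤ (4 * t * n) base-term) ⟩
      (1 + 2 * t) * (2 * n) + n + (n + 4 * t * n)
        ≡⟨ e₂ t n ⟩
      2 * ((1 + 2 * t) * (2 * n)) ∎)
      where
      e₁ : ∀ t h d i n → 2 * ((1 + 2 * t) * (2 * (h + d + i + t)) + 2 * t * n) ≡
        (1 + 2 * t) * (2 * (h + h)) + d * (4 * (1 + 2 * t)) + (4 * (1 + 2 * t) * (i + t) + 4 * t * n)
      e₁ = solve-∀
      e₂ : ∀ t n → (1 + 2 * t) * (2 * n) + n + (n + 4 * t * n) ≡ 2 * ((1 + 2 * t) * (2 * n))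
      e₂ = solve-∀

    cutoff+t≤n : cutoff + t ≤ n
    cutoff+t≤n = *-cancelˡ-≤ 2 (*-cancelˡ-≤ (1 + 2 * t) (m+n≤o⇒m≤o _ cutoff-bound))

    n≡cutoff+ : cutoff + t + slack ≡ n
    n≡cutoff+ = m+[n∸m]≡n cutoff+t≤n

    n≤slack : 2 * t * n ≤ (1 + 2 * t) * (2 * slack)
    n≤slack = +-cancelˡ-≤ ((1 + 2 * t) * (2 * (cutoff + t))) _ _ (begin
      (1 + 2 * t) * (2 * (cutoff + t)) + 2 * t * n                     ≤⟨ cutoff-bound ⟩
      (1 + 2 * t) * (2 * n)                                            ≡⟨ cong (λ x → (1 + 2 * t) * (2 * x)) n≡cutoff+ ⟨
      (1 + 2 * t) * (2 * (cutoff + t + slack))                         ≡⟨ distrib (1 + 2 * t) (cutoff + t) slack ⟩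
      (1 + 2 * t) * (2 * (cutoff + t)) + (1 + 2 * t) * (2 * slack)     ∎)
      where
      distrib : ∀ a b c → a * (2 * (b + c)) ≡ a * (2 * b) + a * (2 * c)
      distrib = solve-∀

    slack-large : 1 + 12 * ((1 + t) * (2 + t)) ≤ slack
    slack-large = *-cancelˡ-≤ 3 (≤-trans (m+n≤o⇒n≤o (base * (i + t)) (m+n≤o⇒m≤o _ N≤n)) (linear-ratio {u = slack} 0<t n≤slack))

    -- With `h = n / 2` and `d = n / base`, the bound `n ≤ 2h + 1` reduces the claim to
    -- `h + 1 ≤ (2 base + 1) d`. This holds because `d` is positive and `n < base + base d`.
    decay-onset : DecayFrom n base onset
    decay-onset = mkDecay (+-cancelʳ-≤ (suc base * d) _ _ (begin
      suc base * (n ∸ (h + d)) + suc base * d        ≡⟨ *-distribˡ-+ (suc base) (n ∸ (h + d)) d ⟨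
      suc base * (n ∸ (h + d) + d)                   ≤⟨ *-monoʳ-≤ (suc base) below ⟩
      suc base * suc h                               ≡⟨ e₁ base h ⟩
      base * suc h + suc h                           ≤⟨ +-monoʳ-≤ (base * suc h) h<  ⟩
      base * suc h + (base * d + base * d)           ≤⟨ m≤m+n _ d ⟩
      base * suc h + (base * d + base * d) + d       ≡⟨ e₂ base h d ⟩
      base * suc (h + d) + suc base * d              ∎))
      where
      h = n / 2
      d = n / base
      e₁ : ∀ b h → (1 + b) * (1 + h) ≡ b * (1 + h) + (1 + h)
      e₁ = solve-∀
      e₂ : ∀ b h d → b * (1 + h) + (b * d + b * d) + d ≡ b * (1 + (h + d)) + (1 + b) * d
      e₂ = solve-∀
      onset≤n : h + d ≤ n
      onset≤n = ≤-trans (m≤m+n _ i) (≤-trans (m≤m+n _ t) cutoff+t≤n)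
      below : n ∸ (h + d) + d ≤ suc h
      below = +-cancelʳ-≤ h _ _ (begin
        n ∸ (h + d) + d + h    ≡⟨ +-assoc (n ∸ (h + d)) d h ⟩
        n ∸ (h + d) + (d + h)  ≡⟨ cong (n ∸ (h + d) +_) (+-comm d h) ⟩
        n ∸ (h + d) + (h + d)  ≡⟨ m∸n+n≡m onset≤n ⟩
        n                      ≤⟨ n≤1+n/2+n/2 n ⟩
        suc h + h              ∎)
      0<d : 0 < d
      0<d = m≥n⇒m/n>0 base≤n
      h< : suc h ≤ base * d + base * d
      h< = begin
        suc h                  ≤⟨ s≤s (m/n≤m n 2) ⟩
        suc n                  ≡⟨ cong suc (m≡m%n+[m/n]*n n base) ⟩
        suc (n % base) + d * base ≤⟨ +-mono-≤ (m%n<n n base) (≤-reflexive (*-comm d base)) ⟩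
        base + base * d        ≤⟨ +-monoˡ-≤ (base * d) (m≤m*n base d {{>-nonZero 0<d}}) ⟩
        base * d + base * d    ∎

-- The theorem in natural numbers, with ε as a fraction

vee-exists : (t p q : ℕ) → 0 < t → 0 < p → ∃ λ N → (n : ℕ) → N ≤ n → (𝓕 : Family n) →
  (t * q + p) * (n C (n / 2)) ≤ q * length (sets 𝓕) →
  Σ (Subset n) λ F → F ∈ sets 𝓕 × Σ (List (Subset n)) λ Gs →
    InducedVeeAbove 𝓕 F Gs × p * n ^ t ≤ q * (length Gs * (2 ^ (t + 3) * t !))
-- The last argument 0 is a placeholder: `threshold` depends only on `t` and `i`.
vee-exists t p q 0<t 0<p = Cutoff.threshold t i 0 , λ n N≤n 𝓕 many →
  let open Cutoff t i n
      L = sets 𝓕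
      small? = λ (G : Subset n) → ∣ G ∣ ≤? cutoff
      M = filter small? L
      M! = Unique.filter⁺ small? (unique 𝓕)
      v , 2+v≡slack = m≤n⇒∃[o]m+o≡n (≤-trans (s≤s (s≤s z≤n)) (slack-large 0<t N≤n))
      F , k , F∈M , far , rich = ∃-rich M! t p q cutoff v 0<t 0<p
        (trans (sym (n≡cutoff+ 0<t N≤n)) (trans (+-assoc cutoff t slack) (cong (λ x → cutoff + (t + x)) (sym 2+v≡slack))))
        (subst (λ x → 2 * t * n ≤ (1 + 2 * t) * (2 * x)) (sym 2+v≡slack) (n≤slack 0<t N≤n))
        (s≤s⁻¹ (≤-trans (slack-large 0<t N≤n) (≤-reflexive (sym 2+v≡slack))))
        (λ G∈M → proj₂ (∈-filter⁻ small? {xs = L} G∈M))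
        (few-large n many (length-filter-split small? L)
          (large≤ {p = p} {q = q} (Unique.filter⁺ (¬? ∘ small?) (unique 𝓕)) (decay-onset 0<t N≤n)
            (≤-trans (m≤m+n _ i) (≤-trans (m≤m+n _ t) (cutoff+t≤n 0<t N≤n)))
            (s≤s z≤n) i-large
            (λ G∈ → ≰⇒> (proj₂ (∈-filter⁻ (¬? ∘ small?) {xs = L} G∈)))))
  in F , proj₁ (∈-filter⁻ small? {xs = L} F∈M) , above F (level k M) ,
     vee 𝓕 M! (λ G∈M → proj₁ (∈-filter⁻ small? {xs = L} G∈M)) (<-≤-trans (m<m+n ∣ F ∣ 0<t) far) ,
     rich
  where
  b = Cutoff.base t 0 0
  -- A constant in `n`, large enough for `i-large` because `p` is at least 1.
  i = 2 * q * (b * b)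
  open ≤-Reasoning
  i-large : 2 * q * (b * b) ≤ p * (b + i)
  i-large = ≤-trans (m≤n+m i b) (m≤n*m (b + i) p {{>-nonZero 0<p}})

  -- Discarding at most `ε/2` central coefficients from `t + ε` leaves `t + ε/2`; the scale `8 q`
  -- matches the bound `t + 3ε/8` for light members.
  few-large : ∀ n {ℓ m r} → let c = n C (n / 2) in
    (t * q + p) * c ≤ q * ℓ → ℓ ≡ m + r → 2 * q * r ≤ p * c → (8 * t * q + 4 * p) * c ≤ 8 * q * m
  few-large n {m = m} {r} many refl large = +-cancelʳ-≤ (4 * (p * c)) _ _ (begin
    (8 * t * q + 4 * p) * c + 4 * (p * c)     ≡⟨ e₁ t q p c ⟩
    8 * ((t * q + p) * c)                     ≤⟨ *-monoʳ-≤ 8 many ⟩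
    8 * (q * (m + r))                         ≡⟨ e₂ q m r ⟩
    8 * q * m + 4 * (2 * q * r)               ≤⟨ +-monoʳ-≤ (8 * q * m) (*-monoʳ-≤ 4 large) ⟩
    8 * q * m + 4 * (p * c)                   ∎)
    where
    c = n C (n / 2)
    e₁ : ∀ t q p c → (8 * t * q + 4 * p) * c + 4 * (p * c) ≡ 8 * ((t * q + p) * c)
    e₁ = solve-∀
    e₂ : ∀ q m r → 8 * (q * (m + r)) ≡ 8 * q * m + 4 * (2 * q * r)
    e₂ = solve-∀

-- Passing between rational and natural inequalities

ℕ→ℚ-≃ : ∀ k → toℚᵘ (ℕ→ℚ k) ℚᵘ.≃ mkℚᵘ (pos k) 0
ℕ→ℚ-≃ k = toℚᵘ-fromℚᵘ (mkℚᵘ (pos k) 0)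

module _ (p d : ℕ) .(coprime : Coprime p (suc d)) where
  private
    ε = mkℚ (pos p) d coprime
    q = suc d

  -- In unnormalised rationals no common factors are cancelled, so the comparison unfolds to a
  -- cross-multiplied integer inequality with explicit denominators.
  [k+ε]*m≤l⇒ : ∀ k {m l} → (ℕ→ℚ k ℚ.+ ε) ℚ.* ℕ→ℚ m ℚ.≤ ℕ→ℚ l → (k * q + p) * m ≤ q * l
  [k+ε]*m≤l⇒ k {m} {l} le
    with ℚᵘ.≤-respʳ-≃ (ℕ→ℚ-≃ l) (ℚᵘ.≤-respˡ-≃ product≃ (toℚᵘ-mono-≤ le))
    where
    product≃ : toℚᵘ ((ℕ→ℚ k ℚ.+ ε) ℚ.* ℕ→ℚ m) ℚᵘ.≃ (mkℚᵘ (pos k) 0 ℚᵘ.+ mkℚᵘ (pos p) d) ℚᵘ.* mkℚᵘ (pos m) 0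
    product≃ = ℚᵘ.≃-trans (toℚᵘ-homo-* (ℕ→ℚ k ℚ.+ ε) (ℕ→ℚ m))
      (ℚᵘ.*-cong (ℚᵘ.≃-trans (toℚᵘ-homo-+ (ℕ→ℚ k) ε) (ℚᵘ.+-congˡ (toℚᵘ ε) (ℕ→ℚ-≃ k))) (ℕ→ℚ-≃ m))
  ... | *≤* le′ = drop‿+≤+ (subst₂ ℤ._≤_ numerators denominators le′)
    where
    open ≡-Reasoning
    numerators : (pos k ℤ.* pos q ℤ.+ pos p ℤ.* pos 1) ℤ.* pos m ℤ.* pos 1 ≡ pos ((k * q + p) * m)
    numerators = begin
      (pos k ℤ.* pos q ℤ.+ pos p ℤ.* pos 1) ℤ.* pos m ℤ.* pos 1 ≡⟨ ℤ.*-identityʳ _ ⟩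
      (pos k ℤ.* pos q ℤ.+ pos p ℤ.* pos 1) ℤ.* pos m           ≡⟨ cong (λ x → (pos k ℤ.* pos q ℤ.+ x) ℤ.* pos m) (ℤ.*-identityʳ (pos p)) ⟩
      (pos k ℤ.* pos q ℤ.+ pos p) ℤ.* pos m                     ≡⟨ cong (λ x → (x ℤ.+ pos p) ℤ.* pos m) (ℤ.pos-* k q) ⟨
      pos (k * q + p) ℤ.* pos m                                 ≡⟨ ℤ.pos-* (k * q + p) m ⟨
      pos ((k * q + p) * m)                                     ∎
    denominators : pos l ℤ.* (pos (suc (d + 0)) ℤ.* pos 1) ≡ pos (q * l)
    denominators = begin
      pos l ℤ.* pos (suc (d + 0) * 1) ≡⟨ cong (λ x → pos l ℤ.* pos x) (trans (*-identityʳ _) (cong suc (+-identityʳ d))) ⟩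
      pos l ℤ.* pos q                 ≡⟨ ℤ.pos-* l q ⟨
      pos (l * q)                     ≡⟨ cong pos (*-comm l q) ⟩
      pos (q * l)                     ∎

  ε*m≤l⇐ : ∀ {m l} → p * m ≤ q * l → ε ℚ.* ℕ→ℚ m ℚ.≤ ℕ→ℚ l
  ε*m≤l⇐ {m} {l} le = toℚᵘ-cancel-≤ (ℚᵘ.≤-respʳ-≃ (ℚᵘ.≃-sym (ℕ→ℚ-≃ l)) (ℚᵘ.≤-respˡ-≃ (ℚᵘ.≃-sym product≃)
    (*≤* (subst₂ ℤ._≤_ numerators denominators (+≤+ le)))))
    where
    product≃ : toℚᵘ (ε ℚ.* ℕ→ℚ m) ℚᵘ.≃ mkℚᵘ (pos p) d ℚᵘ.* mkℚᵘ (pos m) 0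
    product≃ = ℚᵘ.≃-trans (toℚᵘ-homo-* ε (ℕ→ℚ m)) (ℚᵘ.*-congˡ {toℚᵘ ε} (ℕ→ℚ-≃ m))
    numerators : pos (p * m) ≡ pos p ℤ.* pos m ℤ.* pos 1
    numerators = trans (ℤ.pos-* p m) (sym (ℤ.*-identityʳ _))
    denominators : pos (q * l) ≡ pos l ℤ.* pos (suc (d * 1))
    denominators = begin
      pos (q * l)           ≡⟨ cong pos (*-comm q l) ⟩
      pos (l * q)           ≡⟨ ℤ.pos-* l q ⟩
      pos l ℤ.* pos q       ≡⟨ cong (λ x → pos l ℤ.* pos x) (*-identityʳ q) ⟨
      pos l ℤ.* pos (q * 1) ∎
      where open ≡-Reasoning

theorem2p5 : (ε : ℚ) → ℚ.0ℚ ℚ.< ε → (t r : ℕ) → 0 < t → 0 < r →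
    ∃ λ N → (n : ℕ) → N ≤ n → (𝓕 : Family n) →
    (ℕ→ℚ t ℚ.+ ε) ℚ.* ℕ→ℚ (n C (n / 2)) ℚ.≤ ℕ→ℚ (length (sets 𝓕)) →
    Σ (Subset n) λ F → F ∈ sets 𝓕 × Σ (List (Subset n)) λ Gs →
    InducedVeeAbove 𝓕 F Gs × AtLeastδnᵗ ε t n (length Gs)
-- Positivity of ε excludes zero and negative numerators, which leaves `p ≥ 1`.
theorem2p5 (mkℚ (pos zero) d c) (*<* (+<+ ()))
theorem2p5 (mkℚ -[1+ _ ] d c) (*<* ())
theorem2p5 (mkℚ (pos p@(suc _)) d c) _ t r 0<t _ =
  let N , vee-above = vee-exists t p (suc d) 0<t (s≤s z≤n) in
  N , λ n N≤n 𝓕 many →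
    let F , F∈𝓕 , Gs , isVee , large = vee-above n N≤n 𝓕 ([k+ε]*m≤l⇒ p d c t many)
    in F , F∈𝓕 , Gs , isVee , ε*m≤l⇐ p d c large
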